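{- Let $k\ge 3$ and for $1\le a\le k$ let $\beta_{k,a}$ be the set partition of $[k]$ with the two blocks $[k]\setminus\{a\}$ and $\{a\}$. Then: (i) $\beta_{k,1}\sim\beta_{k,k}$; (ii) for all $n>k$ and all $2\le a\le k-1$ we have $|\Pi_n(\beta_{k,a+1})|\le|\Pi_n(\beta_{k,a})|$, with equality if $a<k-1$; consequently $\beta_{k,a}\sim\beta_{k,b}$ whenever $2\le a,b\le k-1$; (iii) $|\Pi_n(\beta_{k,k})|<|\Pi_n(\beta_{k,k-1})|$ for all $n\ge 2k-2$, and consequently $\beta_{k,k}\prec\beta_{k,a}$ for all $2\le a\le k-1$.
   Context: For a finite set $S$ of positive integers and a set partition $\sigma$ of $S$, the standardization of $\sigma$ is the set partition of $\{1,\dots,|S|\}$ obtained by replacing the $i$-th smallest element of $S$ by $i$. For $\sigma\vdash[n]$ and $\tau\vdash[k]$ ($k\le n$), $\sigma$ contains $\tau$ if there is $S\subseteq[n]$ such that the standardization of the restriction of $\sigma$ to $S$ (i.e. the partition of $S$ into the nonempty intersections of blocks of $\sigma$ with $S$) equals $\tau$; otherwise $\sigma$ avoids $\tau$. $\Pi_n(\tau)$ is the set of set partitions of $[n]=\{1,\dots,n\}$ avoiding $\tau$. For $\tau,\pi\vdash[k]$, $\tau\sim\pi$ (Wilf-equivalence) means $|\Pi_n(\tau)|=|\Pi_n(\pi)|$ for all $n>k$. We write $\tau\prec\pi$ if $|\Pi_n(\tau)|\le|\Pi_n(\pi)|$ for all $n>k$ and there exists $m\ge k$ such that $|\Pi_n(\tau)|<|\Pi_n(\pi)|$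 for all $n>m$. -}

module Defs where

open import Data.Nat using (ℕ; zero; suc; _+_; _∸_; _≤_; _<_; _≡ᵇ_)
open import Data.Nat.Properties using (_≟_)
open import Data.Bool using (Bool; true; false; if_then_else_)
open import Data.List using (List; []; _∷_; _++_; [_]; map; length; filter; upTo; concatMap)
open import Data.List.Properties using (≡-dec)
open import Data.List.Relation.Unary.Any using (Any; any?)
open import Data.Maybe using (Maybe; just; nothing)
open import Data.Product using (_×_; ∃)
open import Relation.Nullary using (¬_; Dec; ¬?)

open import Relation.Binary.PropositionalEquality using (_≡_; refl)

-- Encoding: a set partition of [n] = {1,…,n} is represented canonically by its
-- restricted growth string: the list (b₁,…,bₙ) where bᵢ is the index (0-based)
-- of the block containing i, blocks being numbered in order of their minima.

-- All restricted growth strings of length n (= all set partitions of [n]).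
-- rgsFrom n b : strings of length n whose next entry may be any c ≤ b,
-- where b is the number of blocks opened so far.
rgsFrom : ℕ → ℕ → List (List ℕ)
rgsFrom zero    b = [] ∷ []
rgsFrom (suc n) b =
  concatMap (λ c → map (c ∷_) (rgsFrom n (if c ≡ᵇ b then suc b else b))) (upTo (suc b))

Partitions : ℕ → List (List ℕ)
Partitions n = rgsFrom n 0

indexOf : ℕ → List ℕ → Maybe ℕ
indexOf x []       = nothing
indexOf x (y ∷ ys) with x ≡ᵇ y
... | true  = just 0
... | false with indexOf x ys
...   | just i  = just (suc i)
...   | nothing = nothing

-- Standardization: given the block labels (arbitrary naturals) of the elements
-- of a set S listed in increasing order, return the restricted growth string of
-- the induced set partition of {1,…,|S|} (relabel blocks by first occurrence).
stdFrom : List ℕ → List ℕ → List ℕ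
stdFrom seen []       = []
stdFrom seen (x ∷ xs) with indexOf x seen
... | just i  = i ∷ stdFrom seen xs
... | nothing = length seen ∷ stdFrom (seen ++ [ x ]) xs

std : List ℕ → List ℕ
std = stdFrom []

-- subsequences of length k (= restrictions of the labelling to k-subsets S)
subseqs : {A : Set} → ℕ → List A → List (List A)
subseqs zero    xs       = [] ∷ []
subseqs (suc k) []       = []
subseqs (suc k) (x ∷ xs) = map (x ∷_) (subseqs k xs) ++ subseqs (suc k) xs

Contains : List ℕ → List ℕ → Set
Contains σ τ = Any (λ s → std s ≡ τ) (subseqs (length τ) σ)

contains? : (σ τ : List ℕ) → Dec (Contains σ τ)
contains? σ τ = any? (λ s → ≡-dec _≟_ (std s) τ) (subseqs (length τ) σ)

Avoids : List ℕ → List ℕ → Set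
Avoids σ τ = ¬ Contains σ τ

countAvoiders : List ℕ → ℕ → ℕ
countAvoiders τ n = length (filter (λ σ → ¬? (contains? σ τ)) (Partitions n))

_∼_ : List ℕ → List ℕ → Set
τ ∼ π = ∀ n → length τ < n → countAvoiders τ n ≡ countAvoiders π n

_≺_ : List ℕ → List ℕ → Set
τ ≺ π = (∀ n → length τ < n → countAvoiders τ n ≤ countAvoiders π n)
      × (∃ λ m → length τ ≤ m × (∀ n → m < n → countAvoiders τ n < countAvoiders π n))

β : ℕ → ℕ → List ℕ
β k a = std (map (λ i → if suc i ≡ᵇ a then 1 else 0) (upTo k))

private
  t1 : β 4 1 ≡ 0 ∷ 1 ∷ 1 ∷ 1 ∷ []
  t1 = refl
  t2 : β 4 3 ≡ 0 ∷ 0 ∷ 1 ∷ 0 ∷ []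
  t2 = refl
  t3 : length (Partitions 5) ≡ 52
  t3 = refl
  t4 : countAvoiders (0 ∷ 1 ∷ []) 4 ≡ 1
  t4 = refl
  t5 : countAvoiders (0 ∷ 1 ∷ 0 ∷ 1 ∷ []) 5 ≡ 42
  t5 = refl

{-# OPTIONS --safe #-}
-- Let m = k − 2.  For 2 ≤ a ≤ k − 1, a partition avoids β k a iff in every block with
-- m + j elements (j ≥ 1) the elements numbered a − 1, …, a − 1 + j are consecutive integers.
-- Collapsing each of these runs to one element leaves a partition with all blocks of size
-- at most m, together with extra multiplicities on the blocks of size exactly m; this data
-- does not involve a.  A partition avoids β k k iff at most one block has more than m
-- elements and all its elements beyond the m-th form the tail of [n]; moving that tail to
-- the last remaining element of the block injects the avoiders of β k k into those of
-- β k (k − 1), missing every partition with two blocks of more than m elements.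
-- Reversal exchanges β k 1 and β k k.
module Submission where

open import Defs
open import Data.Nat using (ℕ; _+_; _∸_; _≤_; _<_; _*_)
open import Data.Product using (_×_)
open import Relation.Binary.PropositionalEquality using (_≡_)

open import Data.Bool using (true; false; T; if_then_else_)
open import Data.Empty using (⊥-elim)
open import Data.List using (List; []; _∷_; _++_; [_]; map; length; filter; upTo; applyUpTo; replicate; reverse; _ʳ++_)
open import Data.List.Membership.Propositional using (_∈_; find; lose)
open import Data.List.Membership.Propositional.Properties
open import Data.List.Properties
open import Data.List.Relation.Binary.Disjoint.Propositional using (Disjoint)
open import Data.List.Relation.Binary.Pointwise as PW using (Pointwise; []; _∷_)
open import Data.List.Relation.Binary.Sublist.Propositional using (_⊆_; []; _∷_; _∷ʳ_; minimum)
open import Data.List.Relation.Binary.Sublist.Propositional.Properties using (++⁺; reverse⁻)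
open import Data.List.Relation.Unary.All as All using (All; []; _∷_)
import Data.List.Relation.Unary.All.Properties as All
open import Data.List.Relation.Unary.AllPairs as AllPairs using ([]; _∷_)
import Data.List.Relation.Unary.AllPairs.Properties as AllPairs
open import Data.List.Relation.Unary.Any as Any using (here; there)
open import Data.List.Relation.Unary.Unique.Propositional using (Unique)
import Data.List.Relation.Unary.Unique.Propositional.Properties as Unique
open import Data.Maybe using (just; nothing)
open import Data.Maybe.Properties using (just-injective)
open import Data.Nat using (zero; suc; _≡ᵇ_; _≤?_; _<?_; z≤n; s≤s)
open import Data.Nat.Properties
open import Data.Nat.Tactic.RingSolver using (solve-∀)
open import Data.Product using (_,_; ∃; ∃₂; proj₁; proj₂)
open import Data.Sum using (_⊎_; inj₁; inj₂)
open import Function using (_∘_; id)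
open import Relation.Nullary using (¬_; Dec; yes; no; does; ¬?)
open import Relation.Binary.PropositionalEquality hiding ([_]; _≡_)

private variable
  X Y : Set

-- Counting by injective relations

length-insert : (xs : List X) (y : X) (ys : List X) →
  length (xs ++ y ∷ ys) ≡ suc (length (xs ++ ys))
length-insert xs y ys = trans (length-++ xs)
  (trans (+-suc (length xs) (length ys)) (cong suc (sym (length-++ xs))))

∈-delete : (xs : List X) {y z : X} {ys : List X} →
  z ∈ xs ++ y ∷ ys → z ≢ y → z ∈ xs ++ ys
∈-delete xs z∈ z≢y with ∈-++⁻ xs z∈
... | inj₁ z∈xs         = ∈-++⁺ˡ z∈xs
... | inj₂ (here z≡y)   = ⊥-elim (z≢y z≡y)
... | inj₂ (there z∈ys) = ∈-++⁺ʳ xs z∈ys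

-- Remove from `ys` the partner of the head `x`. No later `x′` loses its own partner, since by
-- injectivity a shared partner would give `x ≡ x′`, against uniqueness. A relation replaces a
-- function because the correspondences below are specified by existential data.
pigeonhole-≤ : (R : X → Y → Set) → (∀ {x x′ y} → R x y → R x′ y → x ≡ x′) →
  ∀ {xs} ys → Unique xs → (∀ {x} → x ∈ xs → ∃ λ y → y ∈ ys × R x y) →
  length xs ≤ length ys
pigeonhole-≤ R inj {[]} ys _ total = z≤n
pigeonhole-≤ R inj {x ∷ xs} ys (x∉xs ∷ uniq) total
  with y , y∈ys , Rxy ← total (here refl)
  with as , bs , refl ← ∈-∃++ y∈ys =
  ≤-trans (s≤s (pigeonhole-≤ R inj (as ++ bs) uniq total′))
          (≤-reflexive (sym (length-insert as y bs)))
  where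
  total′ : ∀ {x′} → x′ ∈ xs → ∃ λ y′ → y′ ∈ as ++ bs × R x′ y′
  total′ x′∈xs with y′ , y′∈ , Rx′y′ ← total (there x′∈xs) =
    y′ , ∈-delete as y′∈ (λ { refl → All.lookup x∉xs x′∈xs (inj Rxy Rx′y′) }) , Rx′y′

-- Deleting the missed `y₀` from `ys` leaves all partners in place, so the weak bound applies to a
-- list shorter by one.
pigeonhole-< : (R : X → Y → Set) → (∀ {x x′ y} → R x y → R x′ y → x ≡ x′) →
  ∀ {xs ys} → Unique xs → (∀ {x} → x ∈ xs → ∃ λ y → y ∈ ys × R x y) →
  ∀ {y₀} → y₀ ∈ ys → (∀ {x} → x ∈ xs → ¬ R x y₀) → length xs < length ys
pigeonhole-< R inj {xs} uniq total {y₀} y₀∈ys missed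
  with as , bs , refl ← ∈-∃++ y₀∈ys =
  ≤-trans (s≤s (pigeonhole-≤ R inj (as ++ bs) uniq total′))
          (≤-reflexive (sym (length-insert as y₀ bs)))
  where
  total′ : ∀ {x} → x ∈ xs → ∃ λ y → y ∈ as ++ bs × R x y
  total′ x∈xs with y , y∈ , Rxy ← total x∈xs =
    y , ∈-delete as y∈ (λ { refl → missed x∈xs Rxy }) , Rxy

-- Restricted growth strings

-- An inductive form of membership in `rgsFrom`, so that later recursions follow the word itself.
-- The index is the number of blocks already opened.
data RGS : ℕ → List ℕ → Set where
  []  : ∀ {b} → RGS b []
  old : ∀ {b c w} → c < b → RGS b w → RGS b (c ∷ w)
  new : ∀ {b w} → RGS (suc b) w → RGS b (b ∷ w)

≡ᵇ-refl : ∀ n → (n ≡ᵇ n) ≡ true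
≡ᵇ-refl zero    = refl
≡ᵇ-refl (suc n) = ≡ᵇ-refl n

≢⇒≡ᵇ-false : ∀ {m n} → m ≢ n → (m ≡ᵇ n) ≡ false
≢⇒≡ᵇ-false {m} {n} m≢n with m ≡ᵇ n in eq
... | true  = ⊥-elim (m≢n (≡ᵇ⇒≡ m n (subst T (sym eq) _)))
... | false = refl

≡ᵇ-true⇒≡ : ∀ m n → (m ≡ᵇ n) ≡ true → m ≡ n
≡ᵇ-true⇒≡ m n eq = ≡ᵇ⇒≡ m n (subst T (sym eq) _)

≡ᵇ-false⇒≢ : ∀ m n → (m ≡ᵇ n) ≡ false → m ≢ n
≡ᵇ-false⇒≢ m .m eq refl with () ← trans (sym (≡ᵇ-refl m)) eq

nextBound : ℕ → ℕ → ℕ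
nextBound b c = if c ≡ᵇ b then suc b else b

∈-rgsFrom⁺ : ∀ {b w} → RGS b w → w ∈ rgsFrom (length w) b
∈-rgsFrom⁺ [] = here refl
∈-rgsFrom⁺ {b} {c ∷ w} (old c<b r) =
  ∈-concatMap⁺ _ (Any.map (λ { refl → ∈-map⁺ (c ∷_)
      (subst (λ b′ → w ∈ rgsFrom (length w) b′) (sym bound) (∈-rgsFrom⁺ r)) })
    (∈-upTo⁺ (m<n⇒m<1+n c<b)))
  where
  bound : nextBound b c ≡ b
  bound rewrite ≢⇒≡ᵇ-false (<⇒≢ c<b) = refl
∈-rgsFrom⁺ {b} {.b ∷ w} (new r) =
  ∈-concatMap⁺ _ (Any.map (λ { refl → ∈-map⁺ (b ∷_)
      (subst (λ b′ → w ∈ rgsFrom (length w) b′) (sym bound) (∈-rgsFrom⁺ r)) })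
    (∈-upTo⁺ (n<1+n b)))
  where
  bound : nextBound b b ≡ suc b
  bound rewrite ≡ᵇ-refl b = refl

∈-rgsFrom⁻ : ∀ n {b w} → w ∈ rgsFrom n b → RGS b w × length w ≡ n
∈-rgsFrom⁻ zero (here refl) = [] , refl
∈-rgsFrom⁻ (suc n) {b} w∈
  with c , c∈ , w∈map ← find (∈-concatMap⁻ _ {xs = upTo (suc b)} w∈)
  with w′ , w′∈ , refl ← ∈-map⁻ (c ∷_) w∈map
  with c ≡ᵇ b in eq
... | true with refl ← ≡ᵇ-true⇒≡ c b eq with r , len ← ∈-rgsFrom⁻ n w′∈ =
  new r , cong suc len
... | false with r , len ← ∈-rgsFrom⁻ n w′∈ =
  old (≤∧≢⇒< (≤-pred (∈-upTo⁻ c∈)) (≡ᵇ-false⇒≢ c b eq)) r , cong suc len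

rgsFrom-unique : ∀ n b → Unique (rgsFrom n b)
rgsFrom-unique zero    b = [] ∷ []
rgsFrom-unique (suc n) b = Unique.concat⁺
  (All.map⁺ (All.universal (λ c → Unique.map⁺ ∷-injectiveʳ (rgsFrom-unique n _)) _))
  (AllPairs.map⁺ (AllPairs.map disjoint (Unique.upTo⁺ (suc b))))
  where
  disjoint : ∀ {c d} → c ≢ d → Disjoint (map (c ∷_) (rgsFrom n (nextBound b c)))
                                        (map (d ∷_) (rgsFrom n (nextBound b d)))
  disjoint c≢d (∈c , ∈d) with _ , _ , refl ← ∈-map⁻ _ ∈c | _ , _ , eq ← ∈-map⁻ _ ∈d =
    c≢d (∷-injectiveˡ eq)

-- Every comparison of counts below instantiates this module: reversal, moving the singleton between
-- inner positions, and the last position.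
module _ (τ π : List ℕ) (n : ℕ) (R : List ℕ → List ℕ → Set)
  (R-injective : ∀ {w₁ w₂ w′} → R w₁ w′ → R w₂ w′ → w₁ ≡ w₂)
  (R-total : ∀ {w} → RGS 0 w → length w ≡ n → Avoids w τ →
             ∃ λ w′ → RGS 0 w′ × length w′ ≡ n × Avoids w′ π × R w w′)
  where

  private
    avoiders : List ℕ → List (List ℕ)
    avoiders ρ = filter (λ σ → ¬? (contains? σ ρ)) (Partitions n)

    ∈-avoiders : ∀ {ρ w} → RGS 0 w → length w ≡ n → Avoids w ρ → w ∈ avoiders ρ
    ∈-avoiders r refl av = ∈-filter⁺ _ (∈-rgsFrom⁺ r) av

    avoiders-unique : Unique (avoiders τ)
    avoiders-unique = Unique.filter⁺ _ (rgsFrom-unique n 0)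

    total : ∀ {w} → w ∈ avoiders τ → ∃ λ w′ → w′ ∈ avoiders π × R w w′
    total w∈
      with w∈P , av ← ∈-filter⁻ (λ σ → ¬? (contains? σ τ)) {xs = Partitions n} w∈
      with r , len ← ∈-rgsFrom⁻ n w∈P
      with w′ , r′ , len′ , av′ , Rww′ ← R-total r len av =
      w′ , ∈-avoiders r′ len′ av′ , Rww′

  countAvoiders-≤ : countAvoiders τ n ≤ countAvoiders π n
  countAvoiders-≤ = pigeonhole-≤ R R-injective (avoiders π) avoiders-unique total

  countAvoiders-< : ∀ {w₀} → RGS 0 w₀ → length w₀ ≡ n → Avoids w₀ π →
    (∀ {w} → ¬ R w w₀) → countAvoiders τ n < countAvoiders π n
  countAvoiders-< r₀ len₀ av₀ missed =
    pigeonhole-< R R-injective avoiders-unique total (∈-avoiders r₀ len₀ av₀) (λ _ → missed)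

-- Standardization

indexOf-here : ∀ x ys → indexOf x (x ∷ ys) ≡ just 0
indexOf-here x ys rewrite ≡ᵇ-refl x = refl

indexOf-∷-just : ∀ {x y i} ys → x ≢ y → indexOf x ys ≡ just i → indexOf x (y ∷ ys) ≡ just (suc i)
indexOf-∷-just ys x≢y eq rewrite ≢⇒≡ᵇ-false x≢y | eq = refl

indexOf-∷-nothing : ∀ {x y} ys → x ≢ y → indexOf x ys ≡ nothing → indexOf x (y ∷ ys) ≡ nothing
indexOf-∷-nothing ys x≢y eq rewrite ≢⇒≡ᵇ-false x≢y | eq = refl

indexOf-++ˡ : ∀ {x i} ys {zs} → indexOf x ys ≡ just i → indexOf x (ys ++ zs) ≡ just i
indexOf-++ˡ {x} (y ∷ ys) {zs} eq with x ≡ᵇ y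
... | true = eq
... | false with indexOf x ys in eqs
...   | just j rewrite indexOf-++ˡ ys {zs} eqs = eq

indexOf-++ʳ : ∀ {x} ys {zs} → indexOf x ys ≡ nothing → indexOf x (ys ++ x ∷ zs) ≡ just (length ys)
indexOf-++ʳ {x} [] {zs} eq = indexOf-here x zs
indexOf-++ʳ {x} (y ∷ ys) {zs} eq with x ≡ᵇ y
... | false with indexOf x ys in eqs
...   | nothing rewrite indexOf-++ʳ ys {zs} eqs = refl

indexOf-< : ∀ {x i} ys → indexOf x ys ≡ just i → i < length ys
indexOf-< {x} (y ∷ ys) eq with x ≡ᵇ y
indexOf-< {x} (y ∷ ys) refl | true = s≤s z≤n
... | false with indexOf x ys in eqs
indexOf-< {x} (y ∷ ys) refl | false | just j = s≤s (indexOf-< ys eqs)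

indexOf-injective : ∀ {x y i} zs → indexOf x zs ≡ just i → indexOf y zs ≡ just i → x ≡ y
indexOf-injective {x} {y} (z ∷ zs) eqx eqy with x ≡ᵇ z in xz | y ≡ᵇ z in yz
... | true  | true = trans (≡ᵇ-true⇒≡ x z xz) (sym (≡ᵇ-true⇒≡ y z yz))
... | true  | false with refl ← eqx with indexOf y zs
indexOf-injective {x} {y} (z ∷ zs) refl () | true | false | just _
indexOf-injective {x} {y} (z ∷ zs) refl () | true | false | nothing
indexOf-injective {x} {y} (z ∷ zs) eqx eqy | false | true with refl ← eqy with indexOf x zs
indexOf-injective {x} {y} (z ∷ zs) () refl | false | true | just _
indexOf-injective {x} {y} (z ∷ zs) () refl | false | true | nothing
indexOf-injective {x} {y} (z ∷ zs) eqx eqy | false | false with indexOf x zs in xs | indexOf y zs in ys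
indexOf-injective {x} {y} (z ∷ zs) refl refl | false | false | just _ | just _ =
  indexOf-injective zs xs ys

BiUnique : (ℕ → ℕ → Set) → Set
BiUnique R = ∀ {x x′ y y′} → R x y → R x′ y′ → (x ≡ x′ → y ≡ y′) × (y ≡ y′ → x ≡ x′)

-- Two words induce the same partition of their positions. The witness relates letters and not
-- positions, so it survives restriction to subsequences and reversal unchanged.
SameKernel : List ℕ → List ℕ → Set₁
SameKernel s t = ∃ λ (R : ℕ → ℕ → Set) → BiUnique R × Pointwise R s t

module _ {R : ℕ → ℕ → Set} (bi : BiUnique R) where

  indexOf-resp : ∀ {x y xs ys} → R x y → Pointwise R xs ys → indexOf x xs ≡ indexOf y ys
  indexOf-resp Rxy [] = refl
  indexOf-resp {x} {y} {x′ ∷ xs} {y′ ∷ ys} Rxy (Rxy′ ∷ Rs) with x ≟ x′ | y ≟ y′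
  ... | yes refl | yes refl = trans (indexOf-here x xs) (sym (indexOf-here y ys))
  ... | yes x≡   | no y≢    = ⊥-elim (y≢ (proj₁ (bi Rxy Rxy′) x≡))
  ... | no x≢    | yes y≡   = ⊥-elim (x≢ (proj₂ (bi Rxy Rxy′) y≡))
  ... | no x≢    | no y≢ with indexOf x xs in eqx | indexOf-resp Rxy Rs
  ...   | just i  | eqy = trans (indexOf-∷-just xs x≢ eqx) (sym (indexOf-∷-just ys y≢ (sym eqy)))
  ...   | nothing | eqy = trans (indexOf-∷-nothing xs x≢ eqx) (sym (indexOf-∷-nothing ys y≢ (sym eqy)))

  -- Standardization only tests letters for equality, and a biunique relation preserves every such
  -- test.
  stdFrom-resp : ∀ {xs ys s t} → Pointwise R xs ys → Pointwise R s t → stdFrom xs s ≡ stdFrom ys t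
  stdFrom-resp seen [] = refl
  stdFrom-resp {xs} {ys} {x ∷ s} {y ∷ t} seen (Rxy ∷ Rs)
    with indexOf x xs | indexOf y ys | indexOf-resp Rxy seen
  ... | just i  | .(just i) | refl = cong (i ∷_) (stdFrom-resp seen Rs)
  ... | nothing | .nothing  | refl =
    cong₂ _∷_ (PW.Pointwise-length seen) (stdFrom-resp (PW.++⁺ seen (Rxy ∷ [])) Rs)

sameKernel⇒std-≡ : ∀ {s t} → SameKernel s t → std s ≡ std t
sameKernel⇒std-≡ (R , bi , Rs) = stdFrom-resp bi [] Rs

-- Here `ext` collects the letters that the run still appends to the seen list. Appending never
-- changes an index already assigned, so all output letters are indices into the one final list.
stdFrom-index : ∀ xs s → ∃ λ ext →
  Pointwise (λ x i → indexOf x (xs ++ ext) ≡ just i) s (stdFrom xs s)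
stdFrom-index xs [] = [] , []
stdFrom-index xs (x ∷ s) with indexOf x xs in eq
... | just i with ext , Rs ← stdFrom-index xs s = ext , indexOf-++ˡ xs eq ∷ Rs
... | nothing with ext , Rs ← stdFrom-index (xs ++ [ x ]) s
  rewrite ++-assoc xs [ x ] ext = x ∷ ext , indexOf-++ʳ xs eq ∷ Rs

-- The relation "`x` has index `i` in the list of first occurrences" is biunique: `indexOf` is a
-- function, and equal indices come from equal letters.
std-sameKernel : ∀ s → SameKernel s (std s)
std-sameKernel s with ext , Rs ← stdFrom-index [] s =
  _ , (λ p q → (λ { refl → just-injective (trans (sym p) q) })
             , (λ { refl → indexOf-injective ext p q })) , Rs

sameKernel-sym : ∀ {s t} → SameKernel s t → SameKernel t s
sameKernel-sym (R , bi , Rs) =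
  (λ x y → R y x) , (λ p q → proj₂ (bi p q) , proj₁ (bi p q)) , PW.symmetric id Rs

sameKernel-trans : ∀ {s t u} → SameKernel s t → SameKernel t u → SameKernel s u
sameKernel-trans (R , biR , Rs) (S , biS , Ss) =
  (λ x z → ∃ λ y → R x y × S y z) ,
  (λ { (y , p , q) (y′ , p′ , q′) →
       (proj₁ (biS q q′) ∘ proj₁ (biR p p′)) , (proj₂ (biR p p′) ∘ proj₂ (biS q q′)) }) ,
  PW.transitive (λ p q → _ , p , q) Rs Ss

std-≡⇒sameKernel : ∀ {s t} → std s ≡ std t → SameKernel s t
std-≡⇒sameKernel {s} {t} eq = sameKernel-trans (std-sameKernel s)
  (subst (λ v → SameKernel v t) (sym eq) (sameKernel-sym (std-sameKernel t)))

sameKernel-reverse : ∀ {s t} → SameKernel s t → SameKernel (reverse s) (reverse t)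
sameKernel-reverse (R , bi , Rs) = R , bi , PW.reverse⁺ Rs

std-reverse-cong : ∀ {s t} → std s ≡ std t → std (reverse s) ≡ std (reverse t)
std-reverse-cong {s} {t} eq =
  sameKernel⇒std-≡ (sameKernel-reverse (std-≡⇒sameKernel {s} {t} eq))

sameKernel-length : ∀ {s t} → SameKernel s t → length s ≡ length t
sameKernel-length (_ , _ , Rs) = PW.Pointwise-length Rs

length-std : ∀ s → length (std s) ≡ length s
length-std s = sym (sameKernel-length (std-sameKernel s))

RGS-stdFrom : ∀ xs s → RGS (length xs) (stdFrom xs s)
RGS-stdFrom xs [] = []
RGS-stdFrom xs (x ∷ s) with indexOf x xs in eq
... | just i  = old (indexOf-< xs eq) (RGS-stdFrom xs s)
... | nothing = new (subst (λ b → RGS b (stdFrom (xs ++ [ x ]) s))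
    (trans (length-++ xs) (+-comm (length xs) 1)) (RGS-stdFrom (xs ++ [ x ]) s))

indexOf-applyUpTo : ∀ {c} (f : ℕ → ℕ) b → (∀ {i j} → f i ≡ f j → i ≡ j) → c < b →
  indexOf (f c) (applyUpTo f b) ≡ just c
indexOf-applyUpTo {zero}  f (suc b) inj c<b = indexOf-here (f 0) _
indexOf-applyUpTo {suc c} f (suc b) inj (s≤s c<b) =
  indexOf-∷-just _ (λ eq → 1+n≢0 (inj eq))
    (indexOf-applyUpTo (f ∘ suc) b (suc-injective ∘ inj) c<b)

indexOf-fresh : ∀ {x} ys → All (x ≢_) ys → indexOf x ys ≡ nothing
indexOf-fresh [] [] = refl
indexOf-fresh (y ∷ ys) (x≢y ∷ fresh) = indexOf-∷-nothing ys x≢y (indexOf-fresh ys fresh)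

indexOf-upTo-fresh : ∀ b → indexOf b (upTo b) ≡ nothing
indexOf-upTo-fresh b = indexOf-fresh (upTo b) (All.applyUpTo⁺₁ id b (λ c<b → ≢-sym (<⇒≢ c<b)))

-- While a restricted growth string is read, the seen list is always `upTo b`, in which each letter
-- is its own index.
stdFrom-RGS : ∀ {b w} → RGS b w → stdFrom (upTo b) w ≡ w
stdFrom-RGS [] = refl
stdFrom-RGS {b} {c ∷ w} (old c<b r)
  rewrite indexOf-applyUpTo id b id c<b = cong (c ∷_) (stdFrom-RGS r)
stdFrom-RGS {b} {.b ∷ w} (new r)
  rewrite indexOf-upTo-fresh b | upTo-∷ʳ b = cong₂ _∷_ (length-upTo b) (stdFrom-RGS r)

std-RGS : ∀ {w} → RGS 0 w → std w ≡ w
std-RGS = stdFrom-RGS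

-- Pattern containment

subseqs⁻ : ∀ k {s w : List X} → s ∈ subseqs k w → s ⊆ w × length s ≡ k
subseqs⁻ zero {w = w} (here refl) = minimum w , refl
subseqs⁻ (suc k) {w = x ∷ w} s∈ with ∈-++⁻ (map (x ∷_) (subseqs k w)) s∈
... | inj₁ s∈ˡ with s′ , s′∈ , refl ← ∈-map⁻ (x ∷_) s∈ˡ with s⊆w , len ← subseqs⁻ k s′∈ =
  refl ∷ s⊆w , cong suc len
... | inj₂ s∈ʳ with s⊆w , len ← subseqs⁻ (suc k) s∈ʳ = x ∷ʳ s⊆w , len

subseqs⁺ : ∀ {s w : List X} → s ⊆ w → s ∈ subseqs (length s) w
subseqs⁺ {s = []} {w = w} _ = here refl
subseqs⁺ {s = x ∷ s} {w = y ∷ w} (.y ∷ʳ s⊆w) = ∈-++⁺ʳ (map (y ∷_) (subseqs (length s) w)) (subseqs⁺ s⊆w)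
subseqs⁺ {s = x ∷ s} {w = .x ∷ w} (refl ∷ s⊆w) = ∈-++⁺ˡ (∈-map⁺ (x ∷_) (subseqs⁺ s⊆w))

Contains⁻ : ∀ {σ τ} → Contains σ τ → ∃ λ s → s ⊆ σ × std s ≡ τ
Contains⁻ {τ = τ} con with s , s∈ , eq ← find con = s , proj₁ (subseqs⁻ (length τ) s∈) , eq

Contains⁺ : ∀ {σ s τ} → s ⊆ σ → std s ≡ τ → Contains σ τ
Contains⁺ {σ} {s} s⊆σ refl = lose
  (subst (λ k → s ∈ subseqs k σ) (sym (length-std s)) (subseqs⁺ s⊆σ)) refl

Pointwise-⊆ : ∀ {R : ℕ → ℕ → Set} {s w w′} → Pointwise R w w′ → s ⊆ w →
  ∃ λ s′ → s′ ⊆ w′ × Pointwise R s s′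
Pointwise-⊆ [] [] = [] , [] , []
Pointwise-⊆ (_∷_ {y = y} _ Rs) (_ ∷ʳ s⊆w) with s′ , s′⊆ , Rs′ ← Pointwise-⊆ Rs s⊆w =
  s′ , y ∷ʳ s′⊆ , Rs′
Pointwise-⊆ (_∷_ {y = y} Rxy Rs) (refl ∷ s⊆w) with s′ , s′⊆ , Rs′ ← Pointwise-⊆ Rs s⊆w =
  y ∷ s′ , refl ∷ s′⊆ , Rxy ∷ Rs′

-- An occurrence in `w` is carried to the same positions of `w′`, and the relation restricted to
-- them keeps its standardization.
Contains-resp : ∀ {w w′ τ} → SameKernel w w′ → Contains w τ → Contains w′ τ
Contains-resp (R , bi , Rs) con
  with s , s⊆w , eq ← Contains⁻ con
  with s′ , s′⊆w′ , Rs′ ← Pointwise-⊆ Rs s⊆w =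
  Contains⁺ s′⊆w′ (trans (sym (sameKernel⇒std-≡ (R , bi , Rs′))) eq)

Contains-reverse : ∀ {w} τ → Contains (reverse w) (std τ) → Contains w (std (reverse τ))
Contains-reverse {w} τ con with s , s⊆ , eq ← Contains⁻ con =
  Contains⁺ {s = reverse s} (reverse⁻ (subst (_⊆ reverse w) (sym (reverse-involutive s)) s⊆))
    (std-reverse-cong {s} {τ} eq)

-- The injection is `std (reverse w)`. Reversing and standardizing once more recovers `w`, because
-- `std` fixes restricted growth strings.
countAvoiders-reverse : ∀ τ n →
  countAvoiders (std (reverse τ)) n ≤ countAvoiders (std τ) n
countAvoiders-reverse τ n = countAvoiders-≤ _ _ n
  -- The relation records `RGS 0 w` because injectivity holds only between standardized words.
  (λ w w′ → RGS 0 w × std (reverse w) ≡ w′) injective total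
  where
  injective : ∀ {w₁ w₂ w′} → RGS 0 w₁ × std (reverse w₁) ≡ w′ →
    RGS 0 w₂ × std (reverse w₂) ≡ w′ → w₁ ≡ w₂
  injective {w₁} {w₂} (r₁ , eq₁) (r₂ , eq₂) = begin
    w₁                          ≡⟨ std-RGS r₁ ⟨
    std w₁                      ≡⟨ cong std (reverse-involutive w₁) ⟨
    std (reverse (reverse w₁))  ≡⟨ std-reverse-cong {reverse w₁} {reverse w₂} (trans eq₁ (sym eq₂)) ⟩
    std (reverse (reverse w₂))  ≡⟨ cong std (reverse-involutive w₂) ⟩
    std w₂                      ≡⟨ std-RGS r₂ ⟩
    w₂                          ∎
    where open ≡-Reasoning
  total : ∀ {w} → RGS 0 w → length w ≡ n → Avoids w (std (reverse τ)) → ∃ λ w′ →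
    RGS 0 w′ × length w′ ≡ n × Avoids w′ (std τ) × RGS 0 w × std (reverse w) ≡ w′
  total {w} r len av = std (reverse w) , RGS-stdFrom [] (reverse w) ,
    trans (length-std (reverse w)) (trans (length-reverse w) len) ,
    (λ con → av (Contains-reverse τ
      (Contains-resp (sameKernel-sym (std-sameKernel (reverse w))) con))) ,
    r , refl

-- Multiplicities of letters

when : {P : Set} → Dec P → ℕ → ℕ
when d n = if does d then n else 0

when-yes : {P : Set} (d : Dec P) {n : ℕ} → P → when d n ≡ n
when-yes (yes _) _ = refl
when-yes (no ¬p) p = ⊥-elim (¬p p)

when-no : {P : Set} (d : Dec P) {n : ℕ} → ¬ P → when d n ≡ 0
when-no (yes p) ¬p = ⊥-elim (¬p p)
when-no (no _)  _  = refl

when-0 : {P : Set} (d : Dec P) → when d 0 ≡ 0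
when-0 (yes _) = refl
when-0 (no _)  = refl

-- The contribution of each entry is a summand `when`, so that counting identities can be rearranged
-- by the ring solver without deciding `c ≟ x`.
count : ℕ → List ℕ → ℕ
count c []       = 0
count c (x ∷ xs) = when (c ≟ x) 1 + count c xs

count-∷-≡ : ∀ c xs → count c (c ∷ xs) ≡ suc (count c xs)
count-∷-≡ c xs = cong (_+ count c xs) (when-yes (c ≟ c) refl)

count-∷-≢ : ∀ {c x} xs → c ≢ x → count c (x ∷ xs) ≡ count c xs
count-∷-≢ {c} {x} xs c≢x = cong (_+ count c xs) (when-no (c ≟ x) c≢x)

count-++ : ∀ c xs ys → count c (xs ++ ys) ≡ count c xs + count c ys
count-++ c []       ys = refl
count-++ c (x ∷ xs) ys = trans (cong (when (c ≟ x) 1 +_) (count-++ c xs ys))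
                               (sym (+-assoc (when (c ≟ x) 1) _ _))

count-replicate-≡ : ∀ c n → count c (replicate n c) ≡ n
count-replicate-≡ c zero    = refl
count-replicate-≡ c (suc n) = trans (count-∷-≡ c (replicate n c)) (cong suc (count-replicate-≡ c n))

count-replicate-≢ : ∀ {c x} n → c ≢ x → count c (replicate n x) ≡ 0
count-replicate-≢ zero    c≢x = refl
count-replicate-≢ (suc n) c≢x = trans (count-∷-≢ (replicate n _) c≢x) (count-replicate-≢ n c≢x)

count-⊆ : ∀ c {xs ys} → xs ⊆ ys → count c xs ≤ count c ys
count-⊆ c [] = z≤n
count-⊆ c (y ∷ʳ s) = ≤-trans (count-⊆ c s) (m≤n+m _ _)
count-⊆ c (_∷_ {x = x} refl s) = +-monoʳ-≤ (when (c ≟ x) 1) (count-⊆ c s)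

replicate-⊆ : ∀ c n xs → n ≤ count c xs → replicate n c ⊆ xs
replicate-⊆ c zero    xs       _ = minimum xs
replicate-⊆ c (suc n) (x ∷ xs) n≤ with c ≟ x
... | yes refl = refl ∷ replicate-⊆ c n xs (≤-pred (≤-trans n≤ (≤-reflexive (count-∷-≡ c xs))))
... | no c≢x   = x ∷ʳ replicate-⊆ c (suc n) xs (≤-trans n≤ (≤-reflexive (count-∷-≢ xs c≢x)))

count>0⇒∈ : ∀ c xs → 0 < count c xs → c ∈ xs
count>0⇒∈ c (x ∷ xs) 0< with c ≟ x
... | yes c≡x = here c≡x
... | no c≢x  = there (count>0⇒∈ c xs (≤-trans 0< (≤-reflexive (count-∷-≢ xs c≢x))))

count-insert : ∀ c xs y ys → count c (xs ++ y ∷ ys) ≡ when (c ≟ y) 1 + count c (xs ++ ys)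
count-insert c xs y ys
  rewrite count-++ c xs (y ∷ ys) | count-++ c xs ys =
  solve (count c xs) (when (c ≟ y) 1) (count c ys)
  where
  solve : ∀ a b d → a + (b + d) ≡ b + (a + d)
  solve = solve-∀

-- Delete the head of `xs` from both words and recurse. This shows later that relocating copies of
-- letters preserves the length.
count-≗⇒length-≡ : ∀ xs ys → (∀ c → count c xs ≡ count c ys) → length xs ≡ length ys
count-≗⇒length-≡ [] [] eq = refl
count-≗⇒length-≡ [] (y ∷ ys) eq with () ← trans (eq y) (count-∷-≡ y ys)
count-≗⇒length-≡ (x ∷ xs) ys eq
  with as , bs , refl ← ∈-∃++ (count>0⇒∈ x ys
         (≤-trans (s≤s z≤n) (≤-reflexive (trans (sym (count-∷-≡ x xs)) (eq x)))))
  = trans (cong suc (count-≗⇒length-≡ xs (as ++ bs) (λ c →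
      +-cancelˡ-≡ (when (c ≟ x) 1) _ _ (trans (eq c) (count-insert c as x bs)))))
    (sym (length-insert as x bs))

-- Occurrences of singleton-block patterns

-- Not always a restricted growth string: for `p = 0` the word starts with 1, so patterns are taken
-- as `std (βWord p q)`.
βWord : ℕ → ℕ → List ℕ
βWord p q = replicate p 0 ++ 1 ∷ replicate q 0

Avoidsβ : ℕ → ℕ → List ℕ → Set
Avoidsβ p q w = ∀ {c x} U V → w ≡ U ++ x ∷ V → c ≢ x → p ≤ count c U → count c V < q

++∷-⊆⁻ : ∀ (s₁ : List ℕ) {x s₂ w} → s₁ ++ x ∷ s₂ ⊆ w →
  ∃₂ λ U V → w ≡ U ++ x ∷ V × s₁ ⊆ U × s₂ ⊆ V
++∷-⊆⁻ [] (y ∷ʳ s⊆) with U , V , refl , p , q ← ++∷-⊆⁻ [] s⊆ = y ∷ U , V , refl , y ∷ʳ p , q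
++∷-⊆⁻ [] (refl ∷ s⊆) = [] , _ , refl , [] , s⊆
++∷-⊆⁻ (z ∷ s₁) (y ∷ʳ s⊆) with U , V , refl , p , q ← ++∷-⊆⁻ (z ∷ s₁) s⊆ =
  y ∷ U , V , refl , y ∷ʳ p , q
++∷-⊆⁻ (z ∷ s₁) (refl ∷ s⊆) with U , V , refl , p , q ← ++∷-⊆⁻ s₁ s⊆ =
  z ∷ U , V , refl , refl ∷ p , q

Pointwise-++∷⁻ : ∀ {R : ℕ → ℕ → Set} t₁ {y t₂ s} → Pointwise R s (t₁ ++ y ∷ t₂) →
  ∃ λ s₁ → ∃₂ λ x s₂ → s ≡ s₁ ++ x ∷ s₂ × Pointwise R s₁ t₁ × R x y × Pointwise R s₂ t₂
Pointwise-++∷⁻ [] (Rxy ∷ Rs) = [] , _ , _ , refl , [] , Rxy , Rs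
Pointwise-++∷⁻ (_ ∷ t₁) (Rz ∷ Rs) with s₁ , x , s₂ , refl , Rs₁ , Rxy , Rs₂ ← Pointwise-++∷⁻ t₁ Rs =
  _ ∷ s₁ , x , s₂ , refl , Rz ∷ Rs₁ , Rxy , Rs₂

module _ {R : ℕ → ℕ → Set} (bi : BiUnique R) where

  Pointwise-replicateʳ : ∀ {c y} n {s} → R c y → Pointwise R s (replicate n y) → s ≡ replicate n c
  Pointwise-replicateʳ zero    Rc [] = refl
  Pointwise-replicateʳ (suc n) Rc (Rz ∷ Rs) =
    cong₂ _∷_ (proj₂ (bi Rz Rc) refl) (Pointwise-replicateʳ n Rc Rs)

βWord-kernel : ∀ {c x} p q → c ≢ x → SameKernel (replicate p c ++ x ∷ replicate q c) (βWord p q)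
βWord-kernel {c} {x} p q c≢x = Rel , bi ,
  PW.++⁺ (PW.replicate⁺ (inj₁ (refl , refl)) p) (inj₂ (refl , refl) ∷ PW.replicate⁺ (inj₁ (refl , refl)) q)
  where
  Rel : ℕ → ℕ → Set
  Rel a b = (a ≡ c × b ≡ 0) ⊎ (a ≡ x × b ≡ 1)
  bi : BiUnique Rel
  bi (inj₁ (refl , refl)) (inj₁ (refl , refl)) = (λ _ → refl) , (λ _ → refl)
  bi (inj₁ (refl , refl)) (inj₂ (refl , refl)) = (λ eq → ⊥-elim (c≢x eq)) , (λ ())
  bi (inj₂ (refl , refl)) (inj₁ (refl , refl)) = (λ eq → ⊥-elim (c≢x (sym eq))) , (λ ())
  bi (inj₂ (refl , refl)) (inj₂ (refl , refl)) = (λ _ → refl) , (λ _ → refl)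

Avoids⇒Avoidsβ : ∀ p q {w} → Avoids w (std (βWord p q)) → Avoidsβ p q w
Avoids⇒Avoidsβ p q av {c} {x} U V refl c≢x p≤ = ≰⇒> λ q≤ →
  av (Contains⁺ (++⁺ (replicate-⊆ c p U p≤) (refl ∷ replicate-⊆ c q V q≤))
                (sameKernel⇒std-≡ (βWord-kernel p q c≢x)))

-- 1 ≤ p, since for p = q = 0 the letter of the large block is undetermined.
Avoidsβ⇒Avoids : ∀ p q {w} → 1 ≤ p → Avoidsβ p q w → Avoids w (std (βWord p q))
Avoidsβ⇒Avoids p@(suc _) q {w} (s≤s _) av con
  with s , s⊆w , eq ← Contains⁻ {w} {std (βWord p q)} con
  with R , bi , Rs ← std-≡⇒sameKernel {s} eq
  with s₁ , x , s₂ , refl , Rs₁@(_∷_ {x = c} Rc _) , Rx , Rs₂ ← Pointwise-++∷⁻ (replicate p 0) Rs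
  with U , V , refl , s₁⊆U , s₂⊆V ← ++∷-⊆⁻ s₁ s⊆w
  = <⇒≱ (av U V refl c≢x (subst (_≤ count c U) (count-of p Rs₁) (count-⊆ c s₁⊆U)))
        (subst (_≤ count c V) (count-of q Rs₂) (count-⊆ c s₂⊆V))
  where
  c≢x : c ≢ x
  c≢x c≡x with () ← proj₁ (bi Rc Rx) c≡x
  count-of : ∀ n {t} → Pointwise R t (replicate n 0) → count c t ≡ n
  count-of n Rt = trans (cong (count c) (Pointwise-replicateʳ bi n Rc Rt)) (count-replicate-≡ c n)

-- Expanding a collapsed word

-- expand p e [] u follows the p-th occurrence of each letter x in u by e x further copies
-- of x; the argument s is the reversed prefix of u already read.
extra : ℕ → (ℕ → ℕ) → List ℕ → ℕ → ℕ
extra p e s x = when (p ≟ suc (count x s)) (e x)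

expand : ℕ → (ℕ → ℕ) → List ℕ → List ℕ → List ℕ
expand p e s []      = []
expand p e s (x ∷ u) = replicate (suc (extra p e s x)) x ++ expand p e (x ∷ s) u

expand-cong : ∀ p {e e′} → (∀ c → e c ≡ e′ c) → ∀ s u → expand p e s u ≡ expand p e′ s u
expand-cong p e≗ s []      = refl
expand-cong p e≗ s (x ∷ u) = cong₂ (λ i v → replicate (suc i) x ++ v)
  (cong (when (p ≟ suc (count x s))) (e≗ x)) (expand-cong p e≗ (x ∷ s) u)

expand-injective : ∀ p e s u u′ → expand p e s u ≡ expand p e s u′ → u ≡ u′
expand-injective p e s []      []        eq = refl
expand-injective p e s (x ∷ u) (x′ ∷ u′) eq with refl ← ∷-injectiveˡ eq =
  cong (x ∷_) (expand-injective p e (x ∷ s) u u′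
    (++-cancelˡ (replicate (suc (extra p e s x)) x) _ _ eq))

when-≤-suc : ∀ p t n → when (p ≟ suc t) n + when (p ≤? t) n ≡ when (p ≤? suc t) n
when-≤-suc p t n with p ≤? t
... | yes p≤t rewrite when-no (p ≟ suc t) {n} (<⇒≢ (s≤s p≤t)) =
  trans (when-yes (p ≤? t) p≤t) (sym (when-yes (p ≤? suc t) (m≤n⇒m≤1+n p≤t)))
... | no p≰t with p ≟ suc t
...   | yes refl rewrite when-no (suc t ≤? t) {n} p≰t =
  trans (+-identityʳ _) (trans (when-yes (suc t ≟ suc t) refl) (sym (when-yes (suc t ≤? suc t) ≤-refl)))
...   | no p≢ rewrite when-no (p ≤? t) {n} p≰t =
  trans (+-identityʳ _) (trans (when-no (p ≟ suc t) p≢)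
    (sym (when-no (p ≤? suc t) λ p≤ → p≰t (≤-pred (≤∧≢⇒< p≤ p≢)))))

-- The extra copies of `c` are emitted exactly when its number of occurrences read passes from below
-- `p` to `p`. The `when` on the left accounts for those already emitted before `u`, which avoids
-- subtraction.
count-expand : ∀ p e s u c →
  count c (expand p e s u) + when (p ≤? count c s) (e c)
    ≡ count c u + when (p ≤? count c u + count c s) (e c)
count-expand p e s []      c = refl
count-expand p e s (x ∷ u) c with c ≟ x
... | no c≢x
  rewrite count-++ c (replicate (suc (extra p e s x)) x) (expand p e (x ∷ s) u)
        | count-replicate-≢ (suc (extra p e s x)) c≢x
        | count-∷-≢ u c≢x =
  subst (λ t → count c (expand p e (x ∷ s) u) + when (p ≤? t) (e c)
             ≡ count c u + when (p ≤? count c u + t) (e c))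
    (count-∷-≢ s c≢x) (count-expand p e (x ∷ s) u c)
... | yes refl
  rewrite count-++ c (replicate (suc (extra p e s c)) c) (expand p e (c ∷ s) u)
        | count-replicate-≡ c (suc (extra p e s c))
        | count-∷-≡ c u = cong suc (begin
  (M + E) + B (count c s)                ≡⟨ shuffle M E (B (count c s)) ⟩
  E + (M + B (count c s))                ≡⟨ cong (E +_) (when-≤-suc p (count c s) (e c)) ⟩
  E + B (suc (count c s))                ≡⟨ cong (λ t → E + B t) (count-∷-≡ c s) ⟨
  E + B (count c (c ∷ s))                ≡⟨ count-expand p e (c ∷ s) u c ⟩
  count c u + B (count c u + count c (c ∷ s))
    ≡⟨ cong (λ t → count c u + B t) (trans (cong (count c u +_) (count-∷-≡ c s)) (+-suc _ _)) ⟩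
  count c u + B (suc (count c u + count c s)) ∎)
  where
  open ≡-Reasoning
  M E : ℕ
  M = extra p e s c
  E = count c (expand p e (c ∷ s) u)
  B : ℕ → ℕ
  B t = when (p ≤? t) (e c)
  shuffle : ∀ a b d → (a + b) + d ≡ b + (a + d)
  shuffle = solve-∀

-- The data of a collapsed partition: blocks of size at most `m`, with extra multiplicities only on
-- full blocks. The position `p` of the expansion does not enter, so the same data serve all inner
-- patterns.
Core : ℕ → (ℕ → ℕ) → List ℕ → Set
Core m e u = ∀ c → count c u ≤ m × (0 < e c → count c u ≡ m)

-- A letter with `0 < e c` has `m` copies in `u`, hence reaches its `p`-th copy as `p ≤ m`; for
-- `e c ≡ 0` both outcomes of the test add nothing.
count-expand-core : ∀ {p m} e u → 1 ≤ p → p ≤ m → Core m e u →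
  ∀ c → count c (expand p e [] u) ≡ count c u + e c
count-expand-core {p} {m} e u 1≤p p≤m core c = begin
  count c (expand p e [] u)                                 ≡⟨ +-identityʳ _ ⟨
  count c (expand p e [] u) + 0                             ≡⟨ cong (count c (expand p e [] u) +_) (when-no (p ≤? 0) (<⇒≱ 1≤p)) ⟨
  count c (expand p e [] u) + when (p ≤? 0) (e c)           ≡⟨ count-expand p e [] u c ⟩
  count c u + when (p ≤? count c u + 0) (e c)               ≡⟨ cong (count c u +_) (full (e c) refl) ⟩
  count c u + e c                                           ∎
  where
  open ≡-Reasoning
  full : ∀ n → e c ≡ n → when (p ≤? count c u + 0) n ≡ n
  full zero    _  = when-0 (p ≤? count c u + 0)
  full (suc n) eq = when-yes (p ≤? count c u + 0) (≤-trans p≤m (≤-reflexive (sym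
    (trans (+-identityʳ _) (proj₂ (core c) (≤-trans (s≤s z≤n) (≤-reflexive (sym eq))))))))

-- This recovers `e` from the multiplicities of the expanded word, hence gives its uniqueness.
Core-excess : ∀ {m} e u → Core m e u → ∀ c → (count c u + e c) ∸ m ≡ e c
Core-excess {m} e u core c with e c | proj₂ (core c)
... | zero  | _  = trans (cong (_∸ m) (+-identityʳ _)) (m≤n⇒m∸n≡0 (proj₁ (core c)))
... | suc n | eq rewrite eq (s≤s z≤n) = m+n∸m≡n m (suc n)

-- Once `x` has been read its block is open, so immediate repetitions are `old` and leave the bound
-- for `v` unchanged.
RGS-replicate⁺ : ∀ {b x v} n → RGS b (x ∷ v) → RGS b (replicate (suc n) x ++ v)
RGS-replicate⁺ n (old x<b r) = old x<b (go n)
  where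
  go : ∀ n → RGS _ (replicate n _ ++ _)
  go zero    = r
  go (suc n) = old x<b (go n)
RGS-replicate⁺ n (new r) = new (go n)
  where
  go : ∀ n → RGS _ (replicate n _ ++ _)
  go zero    = r
  go (suc n) = old (n<1+n _) (go n)

RGS-++⁻ʳ-replicate : ∀ {b x v} n → x < b → RGS b (replicate n x ++ v) → RGS b v
RGS-++⁻ʳ-replicate zero    x<b r         = r
RGS-++⁻ʳ-replicate (suc n) x<b (old _ r) = RGS-++⁻ʳ-replicate n x<b r
RGS-++⁻ʳ-replicate (suc n) x<b (new r)   = ⊥-elim (<-irrefl refl x<b)

RGS-replicate⁻ : ∀ {b x v} n → RGS b (replicate (suc n) x ++ v) → RGS b (x ∷ v)
RGS-replicate⁻ n (old x<b r) = old x<b (RGS-++⁻ʳ-replicate n x<b r)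
RGS-replicate⁻ n (new r)     = new (RGS-++⁻ʳ-replicate n (n<1+n _) r)

RGS-++⁻ˡ : ∀ {b} u {v} → RGS b (u ++ v) → RGS b u
RGS-++⁻ˡ []      r           = []
RGS-++⁻ˡ (x ∷ u) (old x<b r) = old x<b (RGS-++⁻ˡ u r)
RGS-++⁻ˡ (x ∷ u) (new r)     = new (RGS-++⁻ˡ u r)

RGS-expand⁺ : ∀ p e s {b u} → RGS b u → RGS b (expand p e s u)
RGS-expand⁺ p e s []          = []
RGS-expand⁺ p e s (old x<b r) = RGS-replicate⁺ _ (old x<b (RGS-expand⁺ p e _ r))
RGS-expand⁺ p e s (new r)     = RGS-replicate⁺ _ (new (RGS-expand⁺ p e _ r))

RGS-expand⁻ : ∀ p e s {b} u → RGS b (expand p e s u) → RGS b u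
RGS-expand⁻ p e s []      r = []
RGS-expand⁻ p e s (x ∷ u) r with RGS-replicate⁻ (extra p e s x) r
... | old x<b r′ = old x<b (RGS-expand⁻ p e (x ∷ s) u r′)
... | new r′     = new (RGS-expand⁻ p e (x ∷ s) u r′)

replicate-++-split : ∀ n {y x : ℕ} {v} U {V} → replicate n y ++ v ≡ U ++ x ∷ V →
  (x ≡ y × ∃₂ λ i j → U ≡ replicate i y × V ≡ replicate j y ++ v)
  ⊎ (∃ λ U′ → U ≡ replicate n y ++ U′ × v ≡ U′ ++ x ∷ V)
replicate-++-split zero    U       eq   = inj₂ (U , refl , eq)
replicate-++-split (suc n) []      refl = inj₁ (refl , 0 , n , refl , refl)
replicate-++-split (suc n) (z ∷ U) eq with refl ← ∷-injectiveˡ eq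
  with replicate-++-split n U (∷-injectiveʳ eq)
... | inj₁ (x≡y , i , j , refl , V≡) = inj₁ (x≡y , suc i , j , refl , V≡)
... | inj₂ (U′ , refl , v≡)          = inj₂ (U′ , refl , v≡)

-- Once p copies of c have been read, the later copies of c in the expansion are
-- exactly those of u.
expand-split : ∀ p e s u {c x} U V → expand p e s u ≡ U ++ x ∷ V → c ≢ x →
  p ≤ count c s + count c U → p + count c V ≤ count c s + count c u
expand-split p e s [] [] V () c≢x
expand-split p e s [] (_ ∷ U) V () c≢x
expand-split p e s (y ∷ u) {c} U V eq c≢x p≤
  with replicate-++-split (suc (extra p e s y)) U eq
-- The position of `x` lies inside the current run, which contains no `c`. Thus `s` alone already
-- has `p` copies of `c`, all extra copies of `c` are behind, and `e c` cancels from `count-expand`.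
... | inj₁ (refl , i , j , refl , refl)
  rewrite count-++ c (replicate j y) (expand p e (y ∷ s) u)
        | count-replicate-≢ j c≢x | count-replicate-≢ i c≢x | +-identityʳ (count c s)
        | count-∷-≢ u c≢x =
  +-mono-≤ p≤ (≤-reflexive (+-cancelʳ-≡ (e c) _ _ (begin
    count c (expand p e (y ∷ s) u) + e c
      ≡⟨ cong (count c (expand p e (y ∷ s) u) +_) (when-yes (p ≤? count c (y ∷ s)) p≤′) ⟨
    count c (expand p e (y ∷ s) u) + when (p ≤? count c (y ∷ s)) (e c)
      ≡⟨ count-expand p e (y ∷ s) u c ⟩
    count c u + when (p ≤? count c u + count c (y ∷ s)) (e c)
      ≡⟨ cong (count c u +_) (when-yes (p ≤? count c u + count c (y ∷ s)) (≤-trans p≤′ (m≤n+m _ (count c u)))) ⟩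
    count c u + e c ∎)))
  where
  open ≡-Reasoning
  p≤′ : p ≤ count c (y ∷ s)
  p≤′ = ≤-trans p≤ (m≤n+m _ _)
... | inj₂ (U′ , refl , eq′) = subst (p + count c V ≤_) shift
  (expand-split p e (y ∷ s) u U′ V eq′ c≢x p≤′)
  where
  t : ℕ
  t = count c s
  comm : ∀ a b d → (a + b) + d ≡ b + (a + d)
  comm = solve-∀
  shift : count c (y ∷ s) + count c u ≡ t + count c (y ∷ u)
  shift = comm (when (c ≟ y) 1) t (count c u)
  p≤′ : p ≤ count c (y ∷ s) + count c U′
  p≤′ with c ≟ y
  ... | no c≢y = subst (p ≤_) (cong₂ _+_ (sym (count-∷-≢ s c≢y))
    (trans (count-++ c (replicate (suc (extra p e s y)) y) U′)
           (cong (_+ count c U′) (count-replicate-≢ (suc (extra p e s y)) c≢y)))) p≤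
  ... | yes refl with p ≟ suc t
  -- At the `p`-th occurrence the prefix including the head supplies the bound by itself; otherwise
  -- there are no extra copies, and a single `c` moves from `U` to the prefix.
  ...   | yes refl = ≤-trans (≤-reflexive (sym (count-∷-≡ c s))) (m≤m+n _ _)
  ...   | no p≢ = subst (p ≤_) (begin
    t + count c (replicate (suc (extra p e s c)) c ++ U′)
      ≡⟨ cong (λ i → t + count c (replicate (suc i) c ++ U′)) (when-no (p ≟ suc t) p≢) ⟩
    t + count c (c ∷ U′)
      ≡⟨ comm (when (c ≟ c) 1) t (count c U′) ⟨
    count c (c ∷ s) + count c U′ ∎) p≤
    where open ≡-Reasoning

-- With `p` copies of `c` before `x`, at most `count c u ∸ p` remain after it, and
-- `count c u ≤ p + q`.
Core⇒Avoidsβ : ∀ p q e u → Core (p + q) e u → Avoidsβ p (suc q) (expand p e [] u)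
Core⇒Avoidsβ p q e u core {c} U V eq c≢x p≤ = s≤s (+-cancelˡ-≤ p _ _
  (≤-trans (expand-split p e [] u U V eq c≢x p≤) (proj₁ (core c))))

-- Every avoider is an expansion

excess : ℕ → List ℕ → ℕ → ℕ
excess m w c = count c w ∸ m

-- A different letter met before `e` copies of `c` are read would have more than `q` copies of `c`
-- behind it. The count is required only for `0 < e`, because `e` will be a truncated difference.
leading-replicate : ∀ c q e v → (0 < e → e + q ≤ count c v) →
  (∀ {x} j v′ → v ≡ replicate j c ++ x ∷ v′ → c ≢ x → count c v′ ≤ q) →
  ∃ λ v′ → v ≡ replicate e c ++ v′
leading-replicate c q zero    v       e≤ gap = v , refl
leading-replicate c q (suc e) []      e≤ gap with () ← e≤ (s≤s z≤n)
leading-replicate c q (suc e) (x ∷ v) e≤ gap with c ≟ x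
... | yes refl
  with v′ , refl ← leading-replicate c q e v
         (λ _ → ≤-pred (≤-trans (e≤ (s≤s z≤n)) (≤-reflexive (count-∷-≡ c v))))
         (λ j v′ eq → gap (suc j) v′ (cong (c ∷_) eq)) = v′ , refl
... | no c≢x = ⊥-elim (<⇒≱ (s≤s (m≤n+m q e)) (≤-trans (e≤ (s≤s z≤n))
  (≤-trans (≤-reflexive (count-∷-≢ v c≢x)) (gap 0 v refl c≢x))))

m∸n>0⇒[m∸n]+n≤m : ∀ m n → 0 < m ∸ n → (m ∸ n) + n ≤ m
m∸n>0⇒[m∸n]+n≤m m n 0< = ≤-reflexive (m∸n+n≡m (<⇒≤ (m∸n≢0⇒n<m {m} {n} (m<n⇒n≢0 0<))))

-- Here `n` and `a` are the multiplicities before and after collapsing. If `m < n`, then `p ≤ a`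
-- gives `n ≡ a + (n ∸ m)` and so `a ≡ m`, while `a < p` would force `n ≡ a < p ≤ m`. If `n ≤ m`,
-- then `a ≤ n ≤ m`.
core-bound : ∀ {p m} a n → p ≤ m → n ≡ a + when (p ≤? a) (n ∸ m) → a ≤ m × (0 < n ∸ m → a ≡ m)
core-bound {p} {m} a n p≤m eq = ≤m (m <? n) , λ 0< → ≡m (m∸n≢0⇒n<m (m<n⇒n≢0 0<))
  where
  ≡m : m < n → a ≡ m
  ≡m m<n with p ≤? a
  ... | yes p≤a = +-cancelʳ-≡ (n ∸ m) a m (trans
    (sym (trans eq (cong (a +_) (when-yes (p ≤? a) p≤a)))) (sym (m+[n∸m]≡n (<⇒≤ m<n))))
  ... | no p≰a = ⊥-elim (p≰a (≤-trans p≤m (≤-trans (<⇒≤ m<n) (≤-reflexive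
    (trans eq (trans (cong (a +_) (when-no (p ≤? a) p≰a)) (+-identityʳ a)))))))
  ≤m : Dec (m < n) → a ≤ m
  ≤m (yes m<n) = ≤-reflexive (≡m m<n)
  ≤m (no m≮n)  = ≤-trans (≤-trans (m≤m+n a _) (≤-reflexive (sym eq))) (≮⇒≥ m≮n)

module _ (p q : ℕ) {w : List ℕ} (av : Avoidsβ p (suc q) w) where

  private
    e : ℕ → ℕ
    e = excess (p + q) w

    -- The loop invariant of the collapse: `W` is the part of `w` read so far and `s` its collapsed
    -- form, reversed.
    Consumed : List ℕ → List ℕ → Set
    Consumed s W = ∀ c → count c W ≡ count c s + when (p ≤? count c s) (e c)

    -- If `x` is now read for the `p`-th time, every other letter further on has `p` copies of `x`
    -- before it, hence at most `q` after it by avoidance. The rest must therefore begin with the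
    -- whole excess.
    run : ∀ {s W x r} → w ≡ W ++ x ∷ r → Consumed s W →
      ∃ λ r′ → r ≡ replicate (extra p e s x) x ++ r′
    run {s} {W} {x} {r} refl consumed with p ≟ suc (count x s)
    ... | no p≢ rewrite when-no (p ≟ suc (count x s)) {e x} p≢ = r , refl
    ... | yes refl rewrite when-yes (suc (count x s) ≟ suc (count x s)) {e x} refl =
      leading-replicate x q (e x) r bound gap
      where
      p′ : ℕ
      p′ = suc (count x s)
      count-W : count x W ≡ count x s
      count-W = trans (consumed x)
        (trans (cong (count x s +_) (when-no (p′ ≤? count x s) 1+n≰n)) (+-identityʳ _))
      count-Wx : ∀ v → count x (W ++ x ∷ v) ≡ p′ + count x v
      count-Wx v = begin
        count x (W ++ x ∷ v)            ≡⟨ count-++ x W (x ∷ v) ⟩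
        count x W + count x (x ∷ v)     ≡⟨ cong₂ _+_ count-W (count-∷-≡ x v) ⟩
        count x s + suc (count x v)     ≡⟨ +-suc (count x s) (count x v) ⟩
        p′ + count x v                  ∎
        where open ≡-Reasoning
      e≡ : e x ≡ count x r ∸ q
      e≡ = trans (cong (_∸ (p′ + q)) (count-Wx r)) ([m+n]∸[m+o]≡n∸o p′ (count x r) q)
      bound : 0 < e x → e x + q ≤ count x r
      bound rewrite e≡ = m∸n>0⇒[m∸n]+n≤m (count x r) q
      gap : ∀ {y} j v → r ≡ replicate j x ++ y ∷ v → x ≢ y → count x v ≤ q
      gap j v refl x≢y = ≤-pred (av (W ++ x ∷ replicate j x) v
        (sym (++-assoc W (x ∷ replicate j x) _)) x≢y
        (≤-trans (m≤m+n p′ _) (≤-reflexive (sym (count-Wx (replicate j x))))))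

    consume : ∀ {s W} x → Consumed s W →
      Consumed (x ∷ s) (W ++ replicate (suc (extra p e s x)) x)
    consume {s} {W} x consumed c with c ≟ x
    ... | no c≢x
      rewrite count-++ c W (replicate (suc (extra p e s x)) x)
            | count-replicate-≢ (suc (extra p e s x)) c≢x
            | count-∷-≢ s c≢x = trans (+-identityʳ _) (consumed c)
    ... | yes refl
      rewrite count-++ c W (replicate (suc (extra p e s c)) c)
            | count-replicate-≡ c (suc (extra p e s c))
            | consumed c | count-∷-≡ c s | sym (when-≤-suc p (count c s) (e c)) =
      shuffle (count c s) (when (p ≤? count c s) (e c)) (extra p e s c)
      where
      shuffle : ∀ a b d → (a + b) + suc d ≡ suc (a + (d + b))
      shuffle = solve-∀

    -- The bound `n` on the length drives the recursion, since stripping a run yields a word that is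
    -- not structurally smaller.
    collapse : ∀ n {s W} r → length r ≤ n → w ≡ W ++ r → Consumed s W →
      ∃ λ u → r ≡ expand p e s u
    collapse n [] _ _ _ = [] , refl
    collapse (suc n) {s} {W} (x ∷ r) len eq consumed
      with r′ , refl ← run {s} {W} eq consumed
      with u , refl ← collapse n {x ∷ s} {W ++ replicate (suc (extra p e s x)) x} r′
             (≤-trans (≤-trans (m≤n+m (length r′) _)
               (≤-reflexive (sym (length-++ (replicate (extra p e s x) x))))) (≤-pred len))
             (trans eq (sym (++-assoc W (replicate (suc (extra p e s x)) x) r′)))
             (consume {s} {W} x consumed)
      = x ∷ u , refl

  Avoidsβ⇒expand : 1 ≤ p → ∃₂ λ e u → Core (p + q) e u × w ≡ expand p e [] u
  Avoidsβ⇒expand 1≤p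
    with u , eq ← collapse (length w) {[]} {[]} w ≤-refl refl
                    -- At the start nothing has been read, and `1 ≤ p` ensures that no extra copies
                    -- are due yet.
                    (λ c → sym (when-no (p ≤? 0) (<⇒≱ 1≤p)))
    = e , u , core , eq
    where
    core : Core (p + q) e u
    core c = core-bound (count c u) (count c w) (m≤m+n p q) (begin
      count c w                                          ≡⟨ +-identityʳ _ ⟨
      count c w + 0                                      ≡⟨ cong₂ (λ v i → count c v + i) eq (sym (when-no (p ≤? 0) (<⇒≱ 1≤p))) ⟩
      count c (expand p e [] u) + when (p ≤? 0) (e c)    ≡⟨ count-expand p e [] u c ⟩
      count c u + when (p ≤? count c u + 0) (e c)        ≡⟨ cong (λ t → count c u + when (p ≤? t) (e c)) (+-identityʳ _) ⟩
      count c u + when (p ≤? count c u) (e c)            ∎)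
      where open ≡-Reasoning

-- Avoiders of the pattern with the singleton last

all-≡⇒replicate : ∀ c (r : List ℕ) → (∀ {x} U V → r ≡ U ++ x ∷ V → c ≡ x) →
  r ≡ replicate (length r) c
all-≡⇒replicate c []      same = refl
all-≡⇒replicate c (x ∷ r) same = cong₂ _∷_ (sym (same [] r refl))
  (all-≡⇒replicate c r (λ U V eq → same (x ∷ U) V (cong (x ∷_) eq)))

-- The tail is encoded as a multiplicity function supported on `c` alone, so that `expand` can
-- relocate it.
Core-replicate : ∀ {m c} j v → (∀ d → count d v ≤ m) → (0 < j → count c v ≡ m) →
  Core m (λ d → count d (replicate j c)) v
Core-replicate {c = c} j v ≤m full d = ≤m d , λ 0< → full′ 0<
  where
  full′ : 0 < count d (replicate j c) → count d v ≡ _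
  full′ 0< with d ≟ c
  ... | yes refl = full (≤-trans 0< (≤-reflexive (count-replicate-≡ d j)))
  ... | no d≢c with () ← subst (0 <_) (count-replicate-≢ j d≢c) 0<

-- Letters move from `r` to `v` until the next one, `x`, already occurs `m` times in `v`. It is then
-- the copy number `m + 1`, and with `q = 0` no other letter may follow it, so the rest consists of
-- copies of `x`.
Avoidsβ⇒tail : ∀ m v r → (∀ d → count d v ≤ m) → Avoidsβ (suc m) 0 (v ++ r) →
  ∃ λ v′ → ∃₂ λ c j → Core m (λ d → count d (replicate j c)) v′ × v ++ r ≡ v′ ++ replicate j c
-- The tail is empty here, so the letter 0 is only a placeholder.
Avoidsβ⇒tail m v [] ≤m av = v , 0 , 0 , Core-replicate {c = 0} 0 v ≤m (λ ()) , refl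
Avoidsβ⇒tail m v (x ∷ r) ≤m av with count x v ≟ m
... | yes full = v , x , suc (length r) , Core-replicate (suc (length r)) v ≤m (λ _ → full) ,
  cong (λ r′ → v ++ x ∷ r′) (all-≡⇒replicate x r same)
  where
  same : ∀ {y} U V → r ≡ U ++ y ∷ V → x ≡ y
  same {y} U V refl with x ≟ y
  ... | yes x≡y = x≡y
  ... | no x≢y with () ← av (v ++ x ∷ U) V (sym (++-assoc v (x ∷ U) (y ∷ V))) x≢y
    (≤-trans (s≤s (≤-trans (≤-reflexive (sym full)) (m≤m+n _ (count x U))))
      (≤-reflexive (sym (trans (count-insert x v x U)
        (cong₂ _+_ (when-yes (x ≟ x) refl) (count-++ x v U))))))
... | no ≢m = subst (λ w → ∃ λ v′ → ∃₂ λ c j →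
    Core m (λ d → count d (replicate j c)) v′ × w ≡ v′ ++ replicate j c)
  (++-assoc v [ x ] r)
  (Avoidsβ⇒tail m (v ++ [ x ]) r ≤m′ (subst (Avoidsβ (suc m) 0) (sym (++-assoc v [ x ] r)) av))
  where
  ≤m′ : ∀ d → count d (v ++ [ x ]) ≤ m
  ≤m′ d rewrite count-insert d v x [] | ++-identityʳ v with d ≟ x
  ... | yes refl = subst (λ i → i + count d v ≤ m) (sym (when-yes (d ≟ d) refl)) (≤∧≢⇒< (≤m d) ≢m)
  ... | no d≢x   = subst (λ i → i + count d v ≤ m) (sym (when-no (d ≟ x) d≢x)) (≤m d)

-- Injections between sets of avoiders

-- Multiplicities beyond `m` determine `e`; for a fixed `e` the expansion is read back letter by
-- letter.
expand-core-injective : ∀ {p m e e′ u u′} → 1 ≤ p → p ≤ m → Core m e u → Core m e′ u′ →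
  expand p e [] u ≡ expand p e′ [] u′ → (∀ c → e c ≡ e′ c) × u ≡ u′
expand-core-injective {p} {m} {e} {e′} {u} {u′} 1≤p p≤m core core′ eq = e≗e′ ,
  expand-injective p e′ [] u u′ (trans (sym (expand-cong p e≗e′ [] u)) eq)
  where
  open ≡-Reasoning
  e≗e′ : ∀ c → e c ≡ e′ c
  e≗e′ c = begin
    e c                              ≡⟨ Core-excess e u core c ⟨
    (count c u + e c) ∸ m            ≡⟨ cong (_∸ m) (count-expand-core e u 1≤p p≤m core c) ⟨
    count c (expand p e [] u) ∸ m    ≡⟨ cong (λ w → count c w ∸ m) eq ⟩
    count c (expand p e′ [] u′) ∸ m  ≡⟨ cong (_∸ m) (count-expand-core e′ u′ 1≤p p≤m core′ c) ⟩
    (count c u′ + e′ c) ∸ m          ≡⟨ Core-excess e′ u′ core′ c ⟩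
    e′ c                             ∎

replicate-count-injective : ∀ {i j c d} →
  (∀ x → count x (replicate i c) ≡ count x (replicate j d)) → replicate i c ≡ replicate j d
replicate-count-injective {i} {j} {c} {d} eq
  with refl ← trans (sym (length-replicate i)) (trans
    (count-≗⇒length-≡ (replicate i c) (replicate j d) eq) (length-replicate j))
  with i
... | zero = refl
... | suc i with c ≟ d
...   | yes refl = refl
...   | no c≢d with () ← trans (sym (count-replicate-≡ c (suc i)))
                               (trans (eq c) (count-replicate-≢ (suc i) c≢d))

-- Collapse at the `p`-th copy and expand the same core at the `p′`-th. Both words have the same
-- letter counts, hence the same length.
countAvoiders-inner-≤ : ∀ {p q p′ q′} n → 1 ≤ p → 1 ≤ p′ → p + q ≡ p′ + q′ →
  countAvoiders (std (βWord p (suc q))) n ≤ countAvoiders (std (βWord p′ (suc q′))) n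
countAvoiders-inner-≤ {p} {q} {p′} {q′} n 1≤p 1≤p′ sum = countAvoiders-≤ _ _ n R injective total
  where
  m : ℕ
  m = p + q
  p′≤m : p′ ≤ m
  p′≤m = subst (p′ ≤_) (sym sum) (m≤m+n p′ q′)
  R : List ℕ → List ℕ → Set
  R w w′ = ∃₂ λ e u → Core m e u × w ≡ expand p e [] u × w′ ≡ expand p′ e [] u
  injective : ∀ {w₁ w₂ w′} → R w₁ w′ → R w₂ w′ → w₁ ≡ w₂
  injective (e₁ , u₁ , core₁ , refl , refl) (e₂ , u₂ , core₂ , refl , eq)
    with e≗ , refl ← expand-core-injective {e = e₁} {e₂} {u₁} {u₂} 1≤p′ p′≤m core₁ core₂ eq =
    expand-cong p e≗ [] u₁
  total : ∀ {w} → RGS 0 w → length w ≡ n → Avoids w (std (βWord p (suc q))) → ∃ λ w′ →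
    RGS 0 w′ × length w′ ≡ n × Avoids w′ (std (βWord p′ (suc q′))) × R w w′
  total {w} r len av
    with e , u , core , refl ← Avoidsβ⇒expand p q (Avoids⇒Avoidsβ p (suc q) av) 1≤p =
    expand p′ e [] u ,
    RGS-expand⁺ p′ e [] (RGS-expand⁻ p e [] u r) ,
    trans (count-≗⇒length-≡ (expand p′ e [] u) (expand p e [] u) (λ c →
      trans (count-expand-core e u 1≤p′ p′≤m core c)
            (sym (count-expand-core e u 1≤p (m≤m+n p q) core c)))) len ,
    Avoidsβ⇒Avoids p′ (suc q′) 1≤p′
      (Core⇒Avoidsβ p′ q′ e u (subst (λ m → Core m e u) sum core)) ,
    e , u , core , refl , refl

module _ {m : ℕ} (1≤m : 1 ≤ m) (n : ℕ) where

  private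
    R : List ℕ → List ℕ → Set
    -- Expanding at `m` puts the tail right after the last `c` of `v`, because a nonempty tail
    -- forces `count c v ≡ m`.
    R w w′ = ∃ λ v → ∃₂ λ c j → Core m (λ d → count d (replicate j c)) v
      × w ≡ v ++ replicate j c × w′ ≡ expand m (λ d → count d (replicate j c)) [] v

    injective : ∀ {w₁ w₂ w′} → R w₁ w′ → R w₂ w′ → w₁ ≡ w₂
    injective (v₁ , c₁ , j₁ , core₁ , refl , refl) (v₂ , c₂ , j₂ , core₂ , refl , eq)
      with e≗ , refl ← expand-core-injective {u = v₁} {v₂} 1≤m ≤-refl core₁ core₂ eq =
      cong (v₁ ++_) (replicate-count-injective {j₁} {j₂} e≗)

    total : ∀ {w} → RGS 0 w → length w ≡ n → Avoids w (std (βWord (suc m) 0)) → ∃ λ w′ →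
      RGS 0 w′ × length w′ ≡ n × Avoids w′ (std (βWord m 1)) × R w w′
    total {w} r len av
      with v , c , j , core , refl ← Avoidsβ⇒tail m [] w (λ _ → z≤n) (Avoids⇒Avoidsβ (suc m) 0 av) =
      w′ ,
      RGS-expand⁺ m e [] (RGS-++⁻ˡ v r) ,
      trans (count-≗⇒length-≡ w′ (v ++ replicate j c) (λ d →
        trans (count-expand-core e v 1≤m ≤-refl core d) (sym (count-++ d v (replicate j c))))) len ,
      Avoidsβ⇒Avoids m 1 1≤m
        (Core⇒Avoidsβ m 0 e v (subst (λ m → Core m e v) (sym (+-identityʳ m)) core)) ,
      v , c , j , core , refl , refl
      where
      e : ℕ → ℕ
      e d = count d (replicate j c)
      w′ : List ℕ
      w′ = expand m e [] v

  countAvoiders-last-≤ : countAvoiders (std (βWord (suc m) 0)) n ≤ countAvoiders (std (βWord m 1)) n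
  countAvoiders-last-≤ = countAvoiders-≤ _ _ n R injective total

  -- The image contains only words with at most one letter occurring more than `m` times. The word
  -- `w₀` has two such letters, the zeros being padded by `a` to reach length `n`.
  countAvoiders-last-< : suc m + suc m ≤ n →
    countAvoiders (std (βWord (suc m) 0)) n < countAvoiders (std (βWord m 1)) n
  countAvoiders-last-< 2m+2≤n = countAvoiders-< _ _ n R injective total
    (RGS-replicate⁺ (m + a) (new (subst (RGS 1) (++-identityʳ _) (RGS-replicate⁺ m (new [])))))
    length-w₀ (Avoidsβ⇒Avoids m 1 1≤m avoids) missed
    where
    a : ℕ
    a = n ∸ (suc m + suc m)
    zeros ones w₀ : List ℕ
    zeros = replicate (suc m + a) 0
    ones  = replicate (suc m) 1
    w₀ = zeros ++ ones
    length-w₀ : length w₀ ≡ n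
    length-w₀ = begin
      length w₀                    ≡⟨ length-++ zeros ⟩
      length zeros + length ones   ≡⟨ cong₂ _+_ (length-replicate (suc m + a)) (length-replicate (suc m)) ⟩
      (suc m + a) + suc m          ≡⟨ shuffle (suc m) a ⟩
      (suc m + suc m) + a          ≡⟨ m+[n∸m]≡n 2m+2≤n ⟩
      n                            ∎
      where
      open ≡-Reasoning
      shuffle : ∀ b d → (b + d) + b ≡ (b + b) + d
      shuffle = solve-∀
    avoids : Avoidsβ m 1 w₀
    avoids {c} U V eq c≢x m≤ with replicate-++-split (suc m + a) U eq
    -- If `x` is a 0, only zeros precede it, so no `c` does, against `1 ≤ m`.
    ... | inj₁ (refl , i , _ , refl , _) =
      ⊥-elim (<⇒≱ 1≤m (≤-trans m≤ (≤-reflexive (count-replicate-≢ i c≢x))))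
    ... | inj₂ (U′ , refl , eq′)
      with replicate-++-split (suc m) U′ (trans (++-identityʳ ones) eq′)
    -- If `x` is a 1, only ones follow it, so no `c` does.
    ...   | inj₁ (refl , _ , j , _ , refl) = s≤s (≤-reflexive
      (trans (cong (count c) (++-identityʳ (replicate j 1))) (count-replicate-≢ j c≢x)))
    ...   | inj₂ ([]    , _ , ())
    ...   | inj₂ (_ ∷ _ , _ , ())
    missed : ∀ {w} → ¬ R w w₀
    -- Only the tail letter `c` can exceed `m`; as 0 and 1 both do, `c` would equal both.
    missed (v , c , j , core , _ , eq) = 0≢1+n (trans
      (only 0 (≤-trans (m≤m+n (suc m) a) (≤-trans
        (≤-reflexive (sym (count-replicate-≡ 0 (suc m + a)))) (count-part 0 (m≤m+n _ _)))))
      (sym (only 1 (≤-trans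
        (≤-reflexive (sym (count-replicate-≡ 1 (suc m)))) (count-part 1 (m≤n+m _ _))))))
      where
      count-part : ∀ d {i} → i ≤ count d zeros + count d ones → i ≤ count d w₀
      count-part d i≤ = ≤-trans i≤ (≤-reflexive (sym (count-++ d zeros ones)))
      only : ∀ d → suc m ≤ count d w₀ → d ≡ c
      only d m< with d ≟ c
      ... | yes d≡c = d≡c
      ... | no d≢c = ⊥-elim (<⇒≱ m< (begin
        count d w₀                              ≡⟨ cong (count d) eq ⟩
        count d (expand m _ [] v)               ≡⟨ count-expand-core _ v 1≤m ≤-refl core d ⟩
        count d v + count d (replicate j c)     ≡⟨ cong (count d v +_) (count-replicate-≢ j d≢c) ⟩
        count d v + 0                           ≡⟨ +-identityʳ _ ⟩
        count d v                               ≤⟨ proj₁ (core d) ⟩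
        m                                       ∎))
        where open ≤-Reasoning

-- The patterns `β k a` as words

replicate-ʳ++ : ∀ i (x : ℕ) ys → replicate i x ʳ++ ys ≡ replicate i x ++ ys
replicate-ʳ++ zero    x ys = refl
replicate-ʳ++ (suc i) x ys = trans (replicate-ʳ++ i x (x ∷ ys)) (shift i)
  where
  shift : ∀ i → replicate i x ++ x ∷ ys ≡ x ∷ replicate i x ++ ys
  shift zero    = refl
  shift (suc i) = cong (x ∷_) (shift i)

reverse-βWord : ∀ q → reverse (βWord 0 q) ≡ βWord q 0
reverse-βWord q = replicate-ʳ++ q 0 [ 1 ]

applyUpTo-const : ∀ (x : ℕ) n → applyUpTo (λ _ → x) n ≡ replicate n x
applyUpTo-const x zero    = refl
applyUpTo-const x (suc n) = cong (x ∷_) (applyUpTo-const x n)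

applyUpTo-βWord : ∀ p q → applyUpTo (λ i → if suc i ≡ᵇ suc p then 1 else 0) (p + suc q) ≡ βWord p q
applyUpTo-βWord zero    q = cong (1 ∷_) (applyUpTo-const 0 q)
applyUpTo-βWord (suc p) q = cong (0 ∷_) (applyUpTo-βWord p q)

-- Since `a` counts from 1, the singleton has `a ∸ 1` elements of the large block before it and
-- `k ∸ a` after it.
β-βWord : ∀ {k a} p q → k ≡ p + suc q → a ≡ suc p → β k a ≡ std (βWord p q)
β-βWord p q refl refl = cong std (trans (map-upTo _ (p + suc q)) (applyUpTo-βWord p q))

length-β : ∀ k a → length (β k a) ≡ k
length-β k a = trans (length-std (map _ (upTo k))) (trans (length-map _ (upTo k)) (length-upTo k))

-- The statements for `k = m + 2`

module _ (m : ℕ) (1≤m : 1 ≤ m) where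

  private
    k : ℕ
    k = suc (suc m)

    Inner : ℕ → Set
    Inner a = 2 ≤ a × a ≤ suc m

    first-≡ : β k 1 ≡ std (βWord 0 (suc m))
    first-≡ = β-βWord 0 (suc m) refl refl

    last-≡ : β k k ≡ std (βWord (suc m) 0)
    last-≡ = β-βWord (suc m) 0 (sym (+-comm (suc m) 1)) refl

    inner-≡ : ∀ {a} → Inner a → ∃₂ λ p q → 1 ≤ p × p + q ≡ m × β k a ≡ std (βWord p (suc q))
    inner-≡ {suc p} (s≤s 1≤p , s≤s p≤m) = p , m ∸ p , 1≤p , m+[n∸m]≡n p≤m ,
      β-βWord p (suc (m ∸ p))
        (sym (trans (+-suc p (suc (m ∸ p))) (cong suc (trans (+-suc p (m ∸ p)) (cong suc (m+[n∸m]≡n p≤m))))))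
        refl

  β-first∼last : β k 1 ∼ β k k
  β-first∼last n _ = subst₂ (λ τ π → countAvoiders τ n ≡ countAvoiders π n)
    (sym first-≡) (sym last-≡) (≤-antisym
      (subst (λ τ → countAvoiders (std τ) n ≤ countAvoiders (std (βWord (suc m) 0)) n)
        (trans (cong reverse (sym (reverse-βWord (suc m)))) (reverse-involutive (βWord 0 (suc m))))
        (countAvoiders-reverse (βWord (suc m) 0) n))
      (subst (λ τ → countAvoiders (std τ) n ≤ countAvoiders (std (βWord 0 (suc m))) n)
        (reverse-βWord (suc m))
        (countAvoiders-reverse (βWord 0 (suc m)) n)))

  β-inner-≤ : ∀ {a b} → Inner a → Inner b → ∀ n → countAvoiders (β k a) n ≤ countAvoiders (β k b) n
  β-inner-≤ ia ib n
    with p , q , 1≤p , sum , eq ← inner-≡ ia | p′ , q′ , 1≤p′ , sum′ , eq′ ← inner-≡ ib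
    = subst₂ (λ τ π → countAvoiders τ n ≤ countAvoiders π n) (sym eq) (sym eq′)
        (countAvoiders-inner-≤ n 1≤p 1≤p′ (trans sum (sym sum′)))

  β-inner-≡ : ∀ {a b} → Inner a → Inner b → ∀ n → countAvoiders (β k a) n ≡ countAvoiders (β k b) n
  β-inner-≡ ia ib n = ≤-antisym (β-inner-≤ ia ib n) (β-inner-≤ ib ia n)

  private
    inner-m : Inner (suc m)
    inner-m = s≤s 1≤m , ≤-refl

    penultimate-≡ : β k (suc m) ≡ std (βWord m 1)
    penultimate-≡ = β-βWord m 1 (+-comm 2 m) refl

  β-last-≤ : ∀ {a} → Inner a → ∀ n → countAvoiders (β k k) n ≤ countAvoiders (β k a) n
  β-last-≤ ia n = ≤-trans
    (subst₂ (λ τ π → countAvoiders τ n ≤ countAvoiders π n) (sym last-≡) (sym penultimate-≡)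
      (countAvoiders-last-≤ 1≤m n))
    (β-inner-≤ inner-m ia n)

  β-last-< : ∀ {a} → Inner a → ∀ n → 2 * k ∸ 2 ≤ n → countAvoiders (β k k) n < countAvoiders (β k a) n
  β-last-< ia n 2k-2≤n = ≤-trans
    (subst₂ (λ τ π → countAvoiders τ n < countAvoiders π n) (sym last-≡) (sym penultimate-≡)
      (countAvoiders-last-< 1≤m n (≤-trans (≤-reflexive (double m)) 2k-2≤n)))
    (β-inner-≤ inner-m ia n)
    where
    -- The right-hand side is what `2 * k ∸ 2` computes to.
    double : ∀ m → suc m + suc m ≡ m + suc (suc (m + 0))
    double = solve-∀

  β-step-≤ : ∀ {a} → Inner a → ∀ n → countAvoiders (β k (a + 1)) n ≤ countAvoiders (β k a) n
  β-step-≤ {a} (2≤a , a≤) n rewrite +-comm a 1 with m≤n⇒m<n∨m≡n a≤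
  -- Either `a + 1` is still an inner position, or `a + 1` is `k` and the comparison is the one with
  -- the last position.
  ... | inj₁ a<   = β-inner-≤ (m≤n⇒m≤1+n 2≤a , a<) (2≤a , a≤) n
  ... | inj₂ refl = β-last-≤ (2≤a , a≤) n

  β-step-≡ : ∀ {a} → 2 ≤ a → a < suc m → ∀ n → countAvoiders (β k (a + 1)) n ≡ countAvoiders (β k a) n
  β-step-≡ {a} 2≤a a< n rewrite +-comm a 1 = β-inner-≡ (m≤n⇒m≤1+n 2≤a , a<) (2≤a , <⇒≤ a<) n

  β-last≺inner : ∀ {a} → Inner a → β k k ≺ β k a
  β-last≺inner ia = (λ n _ → β-last-≤ ia n) , 2 * k ∸ 2 ,
    subst (_≤ 2 * k ∸ 2) (sym (length-β k k)) k≤2k-2 , λ n m<n → β-last-< ia n (<⇒≤ m<n)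
    where
    k≤2k-2 : k ≤ m + suc (suc (m + 0))
    k≤2k-2 = ≤-trans (s≤s (s≤s (m≤m+n m 0))) (m≤n+m _ m)

theorem2p1 : (k : ℕ) → 3 ≤ k →
    (β k 1 ∼ β k k)
    × ((∀ n → k < n → ∀ a → 2 ≤ a → a ≤ k ∸ 1 →
    (countAvoiders (β k (a + 1)) n ≤ countAvoiders (β k a) n)
    × (a < k ∸ 1 → countAvoiders (β k (a + 1)) n ≡ countAvoiders (β k a) n))
    × (∀ a b → 2 ≤ a → a ≤ k ∸ 1 → 2 ≤ b → b ≤ k ∸ 1 → β k a ∼ β k b))
    × ((∀ n → 2 * k ∸ 2 ≤ n → countAvoiders (β k k) n < countAvoiders (β k (k ∸ 1)) n)
    × (∀ a → 2 ≤ a → a ≤ k ∸ 1 → β k k ≺ β k a))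
theorem2p1 (suc (suc m)) (s≤s (s≤s 1≤m)) =
  β-first∼last m 1≤m ,
  ((λ n _ a 2≤a a≤ → β-step-≤ m 1≤m (2≤a , a≤) n , λ a< → β-step-≡ m 1≤m 2≤a a< n) ,
   (λ a b 2≤a a≤ 2≤b b≤ n _ → β-inner-≡ m 1≤m (2≤a , a≤) (2≤b , b≤) n)) ,
  ((λ n → β-last-< m 1≤m (s≤s 1≤m , ≤-refl) n) ,
   (λ a 2≤a a≤ → β-last≺inner m 1≤m (2≤a , a≤)))
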